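{- Let $A$ be a finite alphabet and $A^+$ the set of non-empty words over $A$. The pruning coproduct of the series $H=\sum_{w\in A^+}H_{(w)}$ reads $$\Delta(H)=1\otimes H+H\otimes1+H\otimes H .$$
   Context: $\Bbbk$ is a field of characteristic zero. A sentence over $A$ is a finite sequence of non-empty words in letters of $A$; $1$ is the empty sentence; $I\cdot J$ is concatenation of sequences of words. $\mathrm{NSym}_A$ is the Hopf algebra over $\Bbbk$ with linear basis $(H_I)$ indexed by sentences, graded by the total number of letters, with $H_1=1$, product $H_IH_J=H_{I\cdot J}$, and (pruning) coproduct the algebra morphism $\Delta$ determined by $\Delta(H_{(w)})=\sum_{uv=w}H_{(u)}\otimes H_{(v)}$ for words $w$ (sum over all factorizations into a possibly empty prefix $u$ and suffix $v$, with $H_{(1)}=1$ for the empty word). A formal series is a possibly infinite combination $G=\sum_I g_IH_I$ with $g_I\in\Bbbk$, i.e. an element of the full linear dual of the graded dual $\mathrm{QSym}_A$ of $\mathrm{NSym}_A$. The coproduct is extended to series by $\Delta(G)=\sum_I g_I\Delta(H_I)$, understood coefficientwise as a formal series in the elements $H_J\otimes H_K$, and $G_1\otimes G_2$ for series is understood coefficientwise. -}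

module Defs where

open import Level using (Level; _⊔_)
open import Algebra.Bundles using (CommutativeRing)
open import Algebra.Definitions using (Invertible)
import Algebra.Definitions.RawMonoid as RawMult
import Algebra.Properties.CommutativeSemigroup as CommutativeSemigroupProperties
open import Data.Bool.Base using (if_then_else_)
open import Data.Empty using (⊥-elim)
open import Data.Fin.Base using (Fin)
import Data.Fin.Properties as Fin
open import Data.List.Base using (List; []; _∷_; _++_; length; map; foldr; concatMap; cartesianProductWith; allFin)
import Data.List.Properties as List
open import Data.List.Membership.Propositional using (_∈_; lose; find)
open import Data.List.Membership.Propositional.Properties using (∈-map⁺; ∈-allFin; ∈-concatMap⁺; ∈-concatMap⁻)
open import Data.List.NonEmpty.Base as List⁺ using (List⁺; _∷_; _∷⁺_; toList)
open import Data.List.Relation.Unary.All as All using (All; []; _∷_)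
import Data.List.Relation.Unary.All.Properties as All
open import Data.List.Relation.Unary.AllPairs as AllPairs using ([]; _∷_)
import Data.List.Relation.Unary.AllPairs.Properties as AllPairs
open import Data.List.Relation.Unary.Any using (Any; here; there)
open import Data.List.Relation.Unary.Unique.Propositional using (Unique)
import Data.List.Relation.Unary.Unique.Propositional.Properties as Unique
open import Data.Nat.Base using (ℕ; zero; suc) renaming (_+_ to _+ℕ_)
import Data.Nat.Properties as ℕ
open import Data.Product.Base using (_×_; _,_; proj₁; proj₂; map₁)
import Data.Product.Properties as Product
open import Function.Bundles using (_↔_; Inverse)
open import Function.Properties.Inverse using (↔⇒↣)
open import Relation.Binary.Definitions using (DecidableEquality)
open import Relation.Binary.PropositionalEquality as ≡ using (_≡_; _≢_)
open import Relation.Nullary.Decidable using (yes; no; does; map′; _×-dec_)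
open import Relation.Nullary.Negation using (¬_)

record IsField {c ℓ} (R : CommutativeRing c ℓ) : Set (c ⊔ ℓ) where
  open CommutativeRing R
  field
    1≉0        : ¬ (1# ≈ 0#)
    invertible : ∀ x → ¬ (x ≈ 0#) → Invertible _≈_ 1# _*_ x

HasCharacteristicZero : ∀ {c ℓ} → CommutativeRing c ℓ → Set ℓ
HasCharacteristicZero R = ∀ n → ¬ (suc n · 1# ≈ 0#)
  where
  open CommutativeRing R
  open RawMult +-rawMonoid renaming (_×_ to _·_)

module Linear {c ℓ} (R : CommutativeRing c ℓ) where
  open CommutativeRing R renaming (Carrier to K)

  -- The free module on B.  Terms may repeat a basis element, so linear
  -- combinations are to be compared through their coefficients only.
  Lin : ∀ {b} → Set b → Set (c ⊔ b)
  Lin B = List (K × B)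

  Series : ∀ {b} → Set b → Set (c ⊔ b)
  Series B = B → K

  module _ {b} {B : Set b} where

    basis : B → Lin B
    basis i = (1# , i) ∷ []

    ⟪_,_⟫ : (B → K) → Lin B → K
    ⟪ f , x ⟫ = foldr (λ (a , i) s → a * f i + s) 0# x

    ∑ : List B → (B → K) → K
    ∑ is f = foldr (λ i s → f i + s) 0# is

    infix 4 _≋_
    _≋_ : Series B → Series B → Set (b ⊔ ℓ)
    G ≋ G′ = ∀ i → G i ≈ G′ i

    infixl 6 _⊕_
    _⊕_ : Series B → Series B → Series B
    (G ⊕ G′) i = G i + G′ i

  infixr 7 _⊗_
  _⊗_ : ∀ {b b′} {B : Set b} {B′ : Set b′} → Series B → Series B′ → Series (B × B′)
  (G ⊗ G′) (i , j) = G i * G′ j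

  linearExtension : ∀ {b b′} {B : Set b} {B′ : Set b′} → (B → Lin B′) → Lin B → Lin B′
  linearExtension φ = concatMap (λ (a , i) → map (map₁ (a *_)) (φ i))

  bilinearExtension : ∀ {b} {B : Set b} → (B → B → B) → Lin B → Lin B → Lin B
  bilinearExtension _∙_ = cartesianProductWith (λ (a , i) (a′ , j) → a * a′ , i ∙ j)

  module Coefficients {b} {B : Set b} (_≟_ : DecidableEquality B) where

    δ : B → B → K
    δ i j = if does (j ≟ i) then 1# else 0#

    coeff : Lin B → Series B
    coeff x i = ⟪ δ i , x ⟫

module NSym {c ℓ a n} (R : CommutativeRing c ℓ) {A : Set a} (finite : A ↔ Fin n) where
  open CommutativeRing R renaming (Carrier to K)
  open Linear R

  Word⁺ : Set a
  Word⁺ = List⁺ A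

  Sentence : Set a
  Sentence = List Word⁺

  infix 4 _≟ᴬ_ _≟ᵂ_ _≟ˢ_ _≟ᵀ_
  _≟ᴬ_ : DecidableEquality A
  _≟ᴬ_ = Fin.inj⇒≟ (↔⇒↣ finite)

  _≟ᵂ_ : DecidableEquality Word⁺
  (a ∷ u) ≟ᵂ (b ∷ v) = map′ (λ { (≡.refl , ≡.refl) → ≡.refl }) (λ { ≡.refl → ≡.refl , ≡.refl })
                            (a ≟ᴬ b ×-dec List.≡-dec _≟ᴬ_ u v)

  _≟ˢ_ : DecidableEquality Sentence
  _≟ˢ_ = List.≡-dec _≟ᵂ_

  _≟ᵀ_ : DecidableEquality (Sentence × Sentence)
  _≟ᵀ_ = Product.≡-dec _≟ˢ_ _≟ˢ_

  degree : Sentence → ℕ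
  degree = foldr (λ w d → List⁺.length w +ℕ d) 0

  NSym : Set (c ⊔ a)
  NSym = Lin Sentence

  NSym⊗NSym : Set (c ⊔ a)
  NSym⊗NSym = Lin (Sentence × Sentence)

  open Coefficients _≟ˢ_ public
  open Coefficients _≟ᵀ_ public using () renaming (δ to δ⊗; coeff to coeff⊗)

  H : Sentence → NSym
  H = basis

  infixl 7 _·_ _·⊗_
  _·_ : NSym → NSym → NSym
  _·_ = bilinearExtension _++_

  _++⊗_ : Sentence × Sentence → Sentence × Sentence → Sentence × Sentence
  (I , J) ++⊗ (I′ , J′) = I ++ I′ , J ++ J′

  _·⊗_ : NSym⊗NSym → NSym⊗NSym → NSym⊗NSym
  _·⊗_ = bilinearExtension _++⊗_

  -- A possibly empty word as a sentence; the empty word gives the empty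
  -- sentence, in accordance with the convention H₍₁₎ = 1.
  sentence : List A → Sentence
  sentence []      = []
  sentence (a ∷ u) = (a ∷ u) ∷ []

  factorizations : List A → List (List A × List A)
  factorizations []      = ([] , []) ∷ []
  factorizations (a ∷ w) = ([] , a ∷ w) ∷ map (map₁ (a ∷_)) (factorizations w)

  Δ-word : Word⁺ → NSym⊗NSym
  Δ-word w = map (λ (u , v) → 1# , (sentence u , sentence v)) (factorizations (toList w))

  -- Multiplicative over the words of a sentence; Δ-unit, Δ-multiplicative and
  -- Δ-H-word below confirm that Δ is the algebra morphism with
  -- Δ(H_w) = ∑_{uv=w} H_u ⊗ H_v.
  Δ-sentence : Sentence → NSym⊗NSym
  Δ-sentence = foldr (λ w x → Δ-word w ·⊗ x) (basis ([] , []))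

  Δ : NSym → NSym⊗NSym
  Δ = linearExtension Δ-sentence

  letters : List A
  letters = map (Inverse.from finite) (allFin n)

  prepend : A → Sentence → List Sentence
  prepend a []      = ((a ∷ []) ∷ []) ∷ []
  prepend a (w ∷ I) = ((a ∷ []) ∷ w ∷ I) ∷ ((a ∷⁺ w) ∷ I) ∷ []

  sentencesOfDegree : ℕ → List Sentence
  sentencesOfDegree zero    = [] ∷ []
  sentencesOfDegree (suc d) = concatMap (λ a → concatMap (prepend a) (sentencesOfDegree d)) letters

  -- The sum ∑ g_I Δ(H_I) over all sentences, taken coefficientwise: by
  -- Δ-homogeneous below, only the finitely many I with
  -- degree I = degree J + degree L contribute to H_J ⊗ H_L, and they are
  -- enumerated without repetition (sentencesOfDegree-complete, -sound, -unique).
  Δ̂ : Series Sentence → Series (Sentence × Sentence)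
  Δ̂ G (J , L) = ∑ (sentencesOfDegree (degree J +ℕ degree L)) λ I → G I * coeff⊗ (Δ (H I)) (J , L)

  𝟏 : Series Sentence
  𝟏 = coeff (H [])

  ℋ : Series Sentence
  ℋ (w ∷ []) = 1#
  ℋ _        = 0#

module LinearProperties {c ℓ} (R : CommutativeRing c ℓ) where
  open CommutativeRing R renaming (Carrier to K)
  open Linear R
  open import Relation.Binary.Reasoning.Setoid setoid
  open CommutativeSemigroupProperties +-commutativeSemigroup using (interchange)
  open CommutativeSemigroupProperties *-commutativeSemigroup using (x∙yz≈y∙xz)

  module _ {b} {B : Set b} where

    ⟪⟫-cong : {f g : B → K} → (∀ i → f i ≈ g i) → ∀ x → ⟪ f , x ⟫ ≈ ⟪ g , x ⟫
    ⟪⟫-cong f≈g []            = refl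
    ⟪⟫-cong f≈g ((a , i) ∷ x) = +-cong (*-congˡ (f≈g i)) (⟪⟫-cong f≈g x)

    ⟪⟫-++ : ∀ f (x y : Lin B) → ⟪ f , x ++ y ⟫ ≈ ⟪ f , x ⟫ + ⟪ f , y ⟫
    ⟪⟫-++ f []      y = sym (+-identityˡ _)
    ⟪⟫-++ f (_ ∷ x) y = trans (+-congˡ (⟪⟫-++ f x y)) (sym (+-assoc _ _ _))

    ⟪⟫-0 : (x : Lin B) → ⟪ (λ _ → 0#) , x ⟫ ≈ 0#
    ⟪⟫-0 []            = refl
    ⟪⟫-0 ((a , _) ∷ x) = trans (+-cong (zeroʳ a) (⟪⟫-0 x)) (+-identityˡ 0#)

    ⟪⟫-+ : ∀ f g (x : Lin B) → ⟪ (λ i → f i + g i) , x ⟫ ≈ ⟪ f , x ⟫ + ⟪ g , x ⟫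
    ⟪⟫-+ f g []            = sym (+-identityˡ 0#)
    ⟪⟫-+ f g ((a , i) ∷ x) = trans (+-cong (distribˡ a (f i) (g i)) (⟪⟫-+ f g x)) (interchange _ _ _ _)

    ⟪⟫-* : ∀ a f (x : Lin B) → ⟪ (λ i → a * f i) , x ⟫ ≈ a * ⟪ f , x ⟫
    ⟪⟫-* a f []             = sym (zeroʳ a)
    ⟪⟫-* a f ((a′ , i) ∷ x) = trans (+-cong (x∙yz≈y∙xz a′ a (f i)) (⟪⟫-* a f x)) (sym (distribˡ a _ _))

    ⟪⟫-basis : ∀ f (i : B) → ⟪ f , basis i ⟫ ≈ f i
    ⟪⟫-basis f i = trans (+-identityʳ _) (*-identityˡ (f i))

    ⟪⟫-scale : ∀ f a (x : Lin B) → ⟪ f , map (map₁ (a *_)) x ⟫ ≈ a * ⟪ f , x ⟫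
    ⟪⟫-scale f a []             = sym (zeroʳ a)
    ⟪⟫-scale f a ((a′ , i) ∷ x) = trans (+-cong (*-assoc a a′ (f i)) (⟪⟫-scale f a x)) (sym (distribˡ a _ _))

    ⟪⟫-vanishes : ∀ f (x : Lin B) → All (λ (_ , i) → f i ≈ 0#) x → ⟪ f , x ⟫ ≈ 0#
    ⟪⟫-vanishes f []            []           = refl
    ⟪⟫-vanishes f ((a , i) ∷ x) (fi≈0 ∷ x≈0) =
      trans (+-cong (trans (*-congˡ fi≈0) (zeroʳ a)) (⟪⟫-vanishes f x x≈0)) (+-identityˡ 0#)

  module _ {b b′} {B : Set b} {B′ : Set b′} where

    ⟪⟫-swap : ∀ (f : B → B′ → K) x y →
              ⟪ (λ i → ⟪ f i , y ⟫) , x ⟫ ≈ ⟪ (λ j → ⟪ (λ i → f i j) , x ⟫) , y ⟫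
    ⟪⟫-swap f []            y = sym (⟪⟫-0 y)
    ⟪⟫-swap f ((a , i) ∷ x) y = begin
      a * ⟪ f i , y ⟫ + ⟪ (λ i → ⟪ f i , y ⟫) , x ⟫
        ≈⟨ +-cong (sym (⟪⟫-* a (f i) y)) (⟪⟫-swap f x y) ⟩
      ⟪ (λ j → a * f i j) , y ⟫ + ⟪ (λ j → ⟪ (λ i → f i j) , x ⟫) , y ⟫
        ≈⟨ ⟪⟫-+ (λ j → a * f i j) (λ j → ⟪ (λ i → f i j) , x ⟫) y ⟨
      ⟪ (λ j → a * f i j + ⟪ (λ i → f i j) , x ⟫) , y ⟫ ∎

  ⟪⟫-linear : ∀ {b b′} {B : Set b} {B′ : Set b′} f (φ : B → Lin B′) x →
              ⟪ f , linearExtension φ x ⟫ ≈ ⟪ (λ i → ⟪ f , φ i ⟫) , x ⟫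
  ⟪⟫-linear f φ []            = refl
  ⟪⟫-linear f φ ((a , i) ∷ x) =
    trans (⟪⟫-++ f (map (map₁ (a *_)) (φ i)) (linearExtension φ x))
          (+-cong (⟪⟫-scale f a (φ i)) (⟪⟫-linear f φ x))

  module _ {b} {B : Set b} (_∙_ : B → B → B) where

    ⟪⟫-row : ∀ f a i (y : Lin B) →
             ⟪ f , map (λ (a′ , j) → a * a′ , i ∙ j) y ⟫ ≈ a * ⟪ (λ j → f (i ∙ j)) , y ⟫
    ⟪⟫-row f a i []             = sym (zeroʳ a)
    ⟪⟫-row f a i ((a′ , j) ∷ y) =
      trans (+-cong (*-assoc a a′ _) (⟪⟫-row f a i y)) (sym (distribˡ a _ _))

    ⟪⟫-bilinear : ∀ f (x y : Lin B) →
                  ⟪ f , bilinearExtension _∙_ x y ⟫ ≈ ⟪ (λ i → ⟪ (λ j → f (i ∙ j)) , y ⟫) , x ⟫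
    ⟪⟫-bilinear f []            y = refl
    ⟪⟫-bilinear f ((a , i) ∷ x) y =
      trans (⟪⟫-++ f (map (λ (a′ , j) → a * a′ , i ∙ j) y) (bilinearExtension _∙_ x y))
            (+-cong (⟪⟫-row f a i y) (⟪⟫-bilinear f x y))

module NSymProperties {c ℓ a n} (R : CommutativeRing c ℓ) {A : Set a} (finite : A ↔ Fin n) where
  open CommutativeRing R renaming (Carrier to K)
  open Linear R
  open LinearProperties R
  open NSym R finite
  open import Relation.Binary.Reasoning.Setoid setoid

  private
    ++⊗-assoc : ∀ p q r → (p ++⊗ q) ++⊗ r ≡ p ++⊗ (q ++⊗ r)
    ++⊗-assoc (I , J) (I′ , J′) (I″ , J″) = ≡.cong₂ _,_ (List.++-assoc I I′ I″) (List.++-assoc J J′ J″)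

    Δ-sentence-++ : ∀ f I J → ⟪ f , Δ-sentence (I ++ J) ⟫ ≈ ⟪ f , Δ-sentence I ·⊗ Δ-sentence J ⟫
    Δ-sentence-++ f [] J = sym (trans (⟪⟫-bilinear _++⊗_ f (basis ([] , [])) (Δ-sentence J))
                                      (⟪⟫-basis (λ p → ⟪ (λ q → f (p ++⊗ q)) , Δ-sentence J ⟫) ([] , [])))
    Δ-sentence-++ f (w ∷ I) J = begin
      ⟪ f , Δ-word w ·⊗ Δ-sentence (I ++ J) ⟫
        ≈⟨ ⟪⟫-bilinear _++⊗_ f (Δ-word w) (Δ-sentence (I ++ J)) ⟩
      ⟪ (λ p → ⟪ (λ q → f (p ++⊗ q)) , Δ-sentence (I ++ J) ⟫) , Δ-word w ⟫
        ≈⟨ ⟪⟫-cong (λ p → trans (Δ-sentence-++ (λ q → f (p ++⊗ q)) I J)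
                                (⟪⟫-bilinear _++⊗_ (λ q → f (p ++⊗ q)) (Δ-sentence I) (Δ-sentence J)))
                   (Δ-word w) ⟩
      ⟪ (λ p → ⟪ (λ q → ⟪ (λ r → f (p ++⊗ (q ++⊗ r))) , Δ-sentence J ⟫) , Δ-sentence I ⟫) , Δ-word w ⟫
        ≈⟨ ⟪⟫-cong (λ p → ⟪⟫-cong (λ q → ⟪⟫-cong (λ r → reflexive (≡.cong f (≡.sym (++⊗-assoc p q r))))
                                                 (Δ-sentence J)) (Δ-sentence I)) (Δ-word w) ⟩
      ⟪ (λ p → ⟪ (λ q → ⟪ (λ r → f ((p ++⊗ q) ++⊗ r)) , Δ-sentence J ⟫) , Δ-sentence I ⟫) , Δ-word w ⟫
        ≈⟨ ⟪⟫-bilinear _++⊗_ (λ p → ⟪ (λ r → f (p ++⊗ r)) , Δ-sentence J ⟫) (Δ-word w) (Δ-sentence I) ⟨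
      ⟪ (λ p → ⟪ (λ r → f (p ++⊗ r)) , Δ-sentence J ⟫) , Δ-sentence (w ∷ I) ⟫
        ≈⟨ ⟪⟫-bilinear _++⊗_ f (Δ-sentence (w ∷ I)) (Δ-sentence J) ⟨
      ⟪ f , Δ-sentence (w ∷ I) ·⊗ Δ-sentence J ⟫ ∎

  Δ-multiplicative : ∀ x y → coeff⊗ (Δ (x · y)) ≋ coeff⊗ (Δ x ·⊗ Δ y)
  Δ-multiplicative x y p = begin
    ⟪ f , Δ (x · y) ⟫
      ≈⟨ ⟪⟫-linear f Δ-sentence (x · y) ⟩
    ⟪ (λ I → ⟪ f , Δ-sentence I ⟫) , x · y ⟫
      ≈⟨ ⟪⟫-bilinear _++_ (λ I → ⟪ f , Δ-sentence I ⟫) x y ⟩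
    ⟪ (λ I → ⟪ (λ J → ⟪ f , Δ-sentence (I ++ J) ⟫) , y ⟫) , x ⟫
      ≈⟨ ⟪⟫-cong (λ I → ⟪⟫-cong (λ J → trans (Δ-sentence-++ f I J)
                                             (⟪⟫-bilinear _++⊗_ f (Δ-sentence I) (Δ-sentence J))) y) x ⟩
    ⟪ (λ I → ⟪ (λ J → ⟪ (λ q → ⟪ (λ r → f (q ++⊗ r)) , Δ-sentence J ⟫) , Δ-sentence I ⟫) , y ⟫) , x ⟫
      ≈⟨ ⟪⟫-cong (λ I → ⟪⟫-swap (λ J q → ⟪ (λ r → f (q ++⊗ r)) , Δ-sentence J ⟫) y (Δ-sentence I)) x ⟩
    ⟪ (λ I → ⟪ (λ q → ⟪ (λ J → ⟪ (λ r → f (q ++⊗ r)) , Δ-sentence J ⟫) , y ⟫) , Δ-sentence I ⟫) , x ⟫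
      ≈⟨ ⟪⟫-cong (λ I → ⟪⟫-cong (λ q → ⟪⟫-linear (λ r → f (q ++⊗ r)) Δ-sentence y) (Δ-sentence I)) x ⟨
    ⟪ (λ I → ⟪ (λ q → ⟪ (λ r → f (q ++⊗ r)) , Δ y ⟫) , Δ-sentence I ⟫) , x ⟫
      ≈⟨ ⟪⟫-linear (λ q → ⟪ (λ r → f (q ++⊗ r)) , Δ y ⟫) Δ-sentence x ⟨
    ⟪ (λ q → ⟪ (λ r → f (q ++⊗ r)) , Δ y ⟫) , Δ x ⟫
      ≈⟨ ⟪⟫-bilinear _++⊗_ f (Δ x) (Δ y) ⟨
    ⟪ f , Δ x ·⊗ Δ y ⟫ ∎
    where f = δ⊗ p

  Δ-unit : coeff⊗ (Δ (H [])) ≋ coeff⊗ (basis ([] , []))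
  Δ-unit p = trans (⟪⟫-linear (δ⊗ p) Δ-sentence (H [])) (⟪⟫-basis (λ I → ⟪ δ⊗ p , Δ-sentence I ⟫) [])

  Δ-H-word : ∀ w → coeff⊗ (Δ (H (w ∷ []))) ≋ coeff⊗ (Δ-word w)
  Δ-H-word w p = begin
    ⟪ f , Δ (H (w ∷ [])) ⟫
      ≈⟨ ⟪⟫-linear f Δ-sentence (H (w ∷ [])) ⟩
    ⟪ (λ I → ⟪ f , Δ-sentence I ⟫) , H (w ∷ []) ⟫
      ≈⟨ ⟪⟫-basis (λ I → ⟪ f , Δ-sentence I ⟫) (w ∷ []) ⟩
    ⟪ f , Δ-word w ·⊗ basis ([] , []) ⟫
      ≈⟨ ⟪⟫-bilinear _++⊗_ f (Δ-word w) (basis ([] , [])) ⟩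
    ⟪ (λ q → ⟪ (λ r → f (q ++⊗ r)) , basis ([] , []) ⟫) , Δ-word w ⟫
      ≈⟨ ⟪⟫-cong (λ q → trans (⟪⟫-basis (λ r → f (q ++⊗ r)) ([] , []))
                              (reflexive (≡.cong f (≡.cong₂ _,_ (List.++-identityʳ (proj₁ q))
                                                                (List.++-identityʳ (proj₂ q))))))
                 (Δ-word w) ⟩
    ⟪ f , Δ-word w ⟫ ∎
    where f = δ⊗ p

  private
    degree⊗ : Sentence × Sentence → ℕ
    degree⊗ (J , L) = degree J +ℕ degree L

    ℕ-interchange : ∀ j l j′ l′ → (j +ℕ j′) +ℕ (l +ℕ l′) ≡ (j +ℕ l) +ℕ (j′ +ℕ l′)
    ℕ-interchange j l j′ l′ = CommutativeSemigroupProperties.interchange ℕ.+-commutativeSemigroup j j′ l l′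

    degree-++ : ∀ I J → degree (I ++ J) ≡ degree I +ℕ degree J
    degree-++ []      J = ≡.refl
    degree-++ (w ∷ I) J = ≡.trans (≡.cong (List⁺.length w +ℕ_) (degree-++ I J))
                                  (≡.sym (ℕ.+-assoc (List⁺.length w) (degree I) (degree J)))

    degree-++⊗ : ∀ p q → degree⊗ (p ++⊗ q) ≡ degree⊗ p +ℕ degree⊗ q
    degree-++⊗ (I , J) (I′ , J′) =
      ≡.trans (≡.cong₂ _+ℕ_ (degree-++ I I′) (degree-++ J J′))
              (ℕ-interchange (degree I) (degree J) (degree I′) (degree J′))

    degree-sentence : ∀ u → degree (sentence u) ≡ length u
    degree-sentence []      = ≡.refl
    degree-sentence (a ∷ u) = ℕ.+-identityʳ _

    factorizations-length : ∀ w → All (λ (u , v) → length u +ℕ length v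
                                                     ≡ length w) (factorizations w)
    factorizations-length []      = ≡.refl ∷ []
    factorizations-length (a ∷ w) = ≡.refl ∷ All.map⁺ (All.map (≡.cong suc) (factorizations-length w))

    Δ-word-degree : ∀ w → All (λ (_ , p) → degree⊗ p ≡ List⁺.length w) (Δ-word w)
    Δ-word-degree w = All.map⁺ (All.map (λ { {u , v} eq → ≡.trans (≡.cong₂ _+ℕ_ (degree-sentence u) (degree-sentence v)) eq })
                                        (factorizations-length (toList w)))

    Δ-sentence-degree : ∀ I → All (λ (_ , p) → degree⊗ p ≡ degree I) (Δ-sentence I)
    Δ-sentence-degree []      = ≡.refl ∷ []
    Δ-sentence-degree (w ∷ I) =
      All.cartesianProductWith⁺ (≡.setoid _) (≡.setoid _) _ (Δ-word w) (Δ-sentence I)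
        λ {p} {q} p∈ q∈ → ≡.trans (degree-++⊗ (proj₂ p) (proj₂ q))
          (≡.cong₂ _+ℕ_ (All.lookup (Δ-word-degree w) p∈) (All.lookup (Δ-sentence-degree I) q∈))

    δ⊗-≢ : ∀ p q → q ≢ p → δ⊗ p q ≈ 0#
    δ⊗-≢ p q q≢p with q ≟ᵀ p
    ... | yes q≡p = ⊥-elim (q≢p q≡p)
    ... | no  _   = refl

  Δ-homogeneous : ∀ I J L → degree I ≢ degree J +ℕ degree L → coeff⊗ (Δ (H I)) (J , L) ≈ 0#
  Δ-homogeneous I J L I≢JL = begin
    ⟪ f , Δ (H I) ⟫
      ≈⟨ ⟪⟫-linear f Δ-sentence (H I) ⟩
    ⟪ (λ I → ⟪ f , Δ-sentence I ⟫) , H I ⟫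
      ≈⟨ ⟪⟫-basis (λ I → ⟪ f , Δ-sentence I ⟫) I ⟩
    ⟪ f , Δ-sentence I ⟫
      ≈⟨ ⟪⟫-vanishes f (Δ-sentence I) (All.map (λ { {_ , q} q≡I → δ⊗-≢ (J , L) q λ { ≡.refl → I≢JL (≡.sym q≡I) } })
                                             (Δ-sentence-degree I)) ⟩
    0# ∎
    where f = δ⊗ (J , L)

  private
    ∈-letters : ∀ a → a ∈ letters
    ∈-letters a = ≡.subst (_∈ letters) (Inverse.strictlyInverseʳ finite a)
                          (∈-map⁺ (Inverse.from finite) (∈-allFin (Inverse.to finite a)))

    letters-unique : Unique letters
    letters-unique = Unique.map⁺ from-injective (Unique.allFin⁺ n)
      where
      from-injective : ∀ {i j} → Inverse.from finite i ≡ Inverse.from finite j → i ≡ j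
      from-injective {i} {j} eq = ≡.trans (≡.sym (Inverse.strictlyInverseˡ finite i))
        (≡.trans (≡.cong (Inverse.to finite) eq) (Inverse.strictlyInverseˡ finite j))

    prepend-degree : ∀ {a I J} → J ∈ prepend a I → degree J ≡ suc (degree I)
    prepend-degree {I = []}    (here ≡.refl)         = ≡.refl
    prepend-degree {I = _ ∷ _} (here ≡.refl)         = ≡.refl
    prepend-degree {I = _ ∷ _} (there (here ≡.refl)) = ≡.refl

    prepend-unique : ∀ a I → Unique (prepend a I)
    prepend-unique a []      = [] ∷ []
    prepend-unique a (w ∷ I) = ((λ ()) ∷ []) ∷ [] ∷ []

    prepend-injective : ∀ {a b I J L} → L ∈ prepend a I → L ∈ prepend b J → (a , I) ≡ (b , J)
    prepend-injective {I = []}    {[]}    (here ≡.refl)         (here ≡.refl)         = ≡.refl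
    prepend-injective {I = []}    {_ ∷ _} (here ≡.refl)         (there (here ()))
    prepend-injective {I = _ ∷ _} {[]}    (here ≡.refl)         (here ())
    prepend-injective {I = _ ∷ _} {_ ∷ _} (here ≡.refl)         (here ≡.refl)         = ≡.refl
    prepend-injective {I = _ ∷ _} {_ ∷ _} (here ≡.refl)         (there (here ()))
    prepend-injective {I = _ ∷ _} {[]}    (there (here ≡.refl)) (here ())
    prepend-injective {I = _ ∷ _} {_ ∷ _} (there (here ≡.refl)) (here ())
    prepend-injective {I = _ ∷ _} {_ ∷ _} (there (here ≡.refl)) (there (here ≡.refl)) = ≡.refl

    concatMap-unique : ∀ {b b′} {B : Set b} {B′ : Set b′} (f : B → List B′) {xs} →
                       (∀ x → Unique (f x)) → (∀ {x y z} → z ∈ f x → z ∈ f y → x ≡ y) →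
                       Unique xs → Unique (concatMap f xs)
    concatMap-unique f {xs} f-unique f-injective xs-unique =
      Unique.concat⁺ (All.map⁺ (All.universal f-unique xs))
                     (AllPairs.map⁺ (AllPairs.map (λ x≢y {_} (z∈fx , z∈fy) → x≢y (f-injective z∈fx z∈fy)) xs-unique))

    ∈-prepends⁻ : ∀ {a L} Is → L ∈ concatMap (prepend a) Is → Any (λ I → L ∈ prepend a I) Is
    ∈-prepends⁻ Is = ∈-concatMap⁻ (prepend _) {xs = Is}

  sentencesOfDegree-complete : ∀ I → I ∈ sentencesOfDegree (degree I)
  sentencesOfDegree-complete []            = here ≡.refl
  sentencesOfDegree-complete ((a ∷ u) ∷ I) = complete a u
    where
    first : ∀ a I → ((a ∷ []) ∷ I) ∈ prepend a I
    first a []      = here ≡.refl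
    first a (_ ∷ _) = here ≡.refl

    step : ∀ d a {J L} → J ∈ sentencesOfDegree d → L ∈ prepend a J → L ∈ sentencesOfDegree (suc d)
    step d a J∈ L∈ = ∈-concatMap⁺ _ (lose (∈-letters a) (∈-concatMap⁺ (prepend a) (lose J∈ L∈)))

    complete : ∀ a u → ((a ∷ u) ∷ I) ∈ sentencesOfDegree (degree ((a ∷ u) ∷ I))
    complete a []      = step (degree I) a (sentencesOfDegree-complete I) (first a I)
    complete a (b ∷ u) = step (degree ((b ∷ u) ∷ I)) a (complete b u) (there (here ≡.refl))

  sentencesOfDegree-sound : ∀ d {I} → I ∈ sentencesOfDegree d → degree I ≡ d
  sentencesOfDegree-sound zero    (here ≡.refl) = ≡.refl
  sentencesOfDegree-sound (suc d) I∈ =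
    let a , _ , I∈a = find (∈-concatMap⁻ _ {xs = letters} I∈)
        J , J∈ , I∈J = find (∈-prepends⁻ (sentencesOfDegree d) I∈a)
    in ≡.trans (prepend-degree I∈J) (≡.cong suc (sentencesOfDegree-sound d J∈))

  sentencesOfDegree-unique : ∀ d → Unique (sentencesOfDegree d)
  sentencesOfDegree-unique zero    = [] ∷ []
  sentencesOfDegree-unique (suc d) = concatMap-unique _
    (λ a → concatMap-unique (prepend a) (prepend-unique a)
             (λ p q → ≡.cong proj₂ (prepend-injective p q)) (sentencesOfDegree-unique d))
    (λ p q → let _ , _ , p′ = find (∈-prepends⁻ (sentencesOfDegree d) p)
                 _ , _ , q′ = find (∈-prepends⁻ (sentencesOfDegree d) q)
             in ≡.cong proj₁ (prepend-injective p′ q′))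
    letters-unique

{-# OPTIONS --safe #-}

-- The words w whose coproduct contains H_J ⊗ H_L are exactly those with
-- w = uv, where J and L are the sentences of the possibly empty words u and v;
-- as u and v are then determined by J and L, the coefficient of Δ(H) at (J , L)
-- is 1 if J and L have at most one word each and are not both empty, and 0 otherwise.
module Submission where

open import Algebra.Bundles using (CommutativeRing)
open import Data.Empty using (⊥-elim)
open import Data.Fin.Base using (Fin)
open import Data.List.Base using (List; []; _∷_; _++_; length; map)
import Data.List.Properties as List
open import Data.List.Membership.Propositional using (_∈_)
open import Data.List.Membership.Propositional.Properties using (∈-map⁺)
open import Data.List.NonEmpty.Base using (List⁺; _∷_; toList)
open import Data.List.Relation.Unary.All as All using (All; []; _∷_)
import Data.List.Relation.Unary.All.Properties as All
open import Data.List.Relation.Unary.AllPairs using ([]; _∷_)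
open import Data.List.Relation.Unary.Any using (here; there)
open import Data.List.Relation.Unary.Unique.Propositional using (Unique)
import Data.List.Relation.Unary.Unique.Propositional.Properties as Unique
open import Data.Nat.Base using () renaming (_+_ to _+ℕ_)
import Data.Nat.Properties as ℕ
open import Data.Product.Base using (_×_; _,_; proj₁; proj₂)
open import Function.Base using (_∘_)
open import Function.Bundles using (_↔_)
open import Relation.Binary.PropositionalEquality as ≡ using (_≡_; _≢_)
open import Relation.Nullary.Decidable using (yes; no)
open import Defs

module SumProperties {c ℓ} (R : CommutativeRing c ℓ) where
  open CommutativeRing R renaming (Carrier to K)
  open Linear R

  module _ {b} {B : Set b} {f : B → K} where

    ∑-vanishes : ∀ {is} → All (λ i → f i ≈ 0#) is → ∑ is f ≈ 0#
    ∑-vanishes []           = refl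
    ∑-vanishes (fi≈0 ∷ f≈0) = trans (+-cong fi≈0 (∑-vanishes f≈0)) (+-identityˡ 0#)

    -- `Unique` matters because a repeated `i` would contribute `f i` once per occurrence.
    ∑-single : ∀ {is i} → Unique is → i ∈ is → (∀ {j} → j ≢ i → f j ≈ 0#) → ∑ is f ≈ f i
    ∑-single (i∉is ∷ _) (here ≡.refl) f≈0 =
      trans (+-congˡ (∑-vanishes (All.map (λ i≢j → f≈0 (i≢j ∘ ≡.sym)) i∉is))) (+-identityʳ _)
    ∑-single (j∉is ∷ is-unique) (there i∈is) f≈0 =
      trans (+-cong (f≈0 (All.lookup j∉is i∈is)) (∑-single is-unique i∈is f≈0)) (+-identityˡ _)

    -- Fits the shape of `Δ-word`, whose terms all carry the scalar `1#`.
    ⟪⟫-∑ : ∀ {b′} {B′ : Set b′} (φ : B′ → B) is → ⟪ f , map (λ i → 1# , φ i) is ⟫ ≈ ∑ is (f ∘ φ)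
    ⟪⟫-∑ φ []       = refl
    ⟪⟫-∑ φ (i ∷ is) = +-cong (*-identityˡ _) (⟪⟫-∑ φ is)

module PruningCoproduct {c ℓ a n} (R : CommutativeRing c ℓ) {A : Set a} (finite : A ↔ Fin n) where
  open CommutativeRing R renaming (Carrier to K)
  open Linear R
  open LinearProperties R
  open SumProperties R
  open NSym R finite
  open NSymProperties R finite

  δ⊗-refl : ∀ p → δ⊗ p p ≈ 1#
  δ⊗-refl p with p ≟ᵀ p
  ... | yes _  = refl
  ... | no p≢p = ⊥-elim (p≢p ≡.refl)

  δ⊗-≢ : ∀ {p q} → q ≢ p → δ⊗ p q ≈ 0#
  δ⊗-≢ {p} {q} q≢p with q ≟ᵀ p
  ... | yes q≡p = ⊥-elim (q≢p q≡p)
  ... | no _    = refl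

  factorizations-sound : ∀ w → All (λ (u , v) → u ++ v ≡ w) (factorizations w)
  factorizations-sound []      = ≡.refl ∷ []
  factorizations-sound (a ∷ w) = ≡.refl ∷ All.map⁺ (All.map (≡.cong (a ∷_)) (factorizations-sound w))

  factorizations-complete : ∀ u v → (u , v) ∈ factorizations (u ++ v)
  factorizations-complete []      []      = here ≡.refl
  factorizations-complete []      (_ ∷ _) = here ≡.refl
  factorizations-complete (a ∷ u) v       = there (∈-map⁺ _ (factorizations-complete u v))

  factorizations-unique : ∀ w → Unique (factorizations w)
  factorizations-unique []      = [] ∷ []
  factorizations-unique (a ∷ w) =
    -- Every later factorization has a prefix beginning with `a`, so it differs from the first one,
    -- whose prefix is empty.
    All.map⁺ (All.universal (λ _ ()) (factorizations w)) ∷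
    Unique.map⁺ (λ { ≡.refl → ≡.refl }) (factorizations-unique w)

  sentence⊗ : List A × List A → Sentence × Sentence
  sentence⊗ (u , v) = sentence u , sentence v

  sentence-injective : ∀ {u v} → sentence u ≡ sentence v → u ≡ v
  sentence-injective {[]}    {[]}    _      = ≡.refl
  sentence-injective {_ ∷ _} {_ ∷ _} ≡.refl = ≡.refl

  sentence⊗-injective : ∀ {p q} → sentence⊗ p ≡ sentence⊗ q → p ≡ q
  sentence⊗-injective eq = ≡.cong₂ _,_ (sentence-injective (≡.cong proj₁ eq))
                                       (sentence-injective (≡.cong proj₂ eq))

  coeff-Δ-H-word : ∀ w p →
    coeff⊗ (Δ (H (w ∷ []))) p ≈ ∑ (factorizations (toList w)) (δ⊗ p ∘ sentence⊗)
  coeff-Δ-H-word w p = trans (Δ-H-word w p) (⟪⟫-∑ sentence⊗ (factorizations (toList w)))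

  -- The factorization `(u , v)` is listed exactly once, and by injectivity of `sentence⊗` no other
  -- factorization yields the same basis element.
  coeff-Δ-H-word-1 : ∀ u v w → u ++ v ≡ toList w →
    coeff⊗ (Δ (H (w ∷ []))) (sentence⊗ (u , v)) ≈ 1#
  coeff-Δ-H-word-1 u v w uv≡w =
    trans (coeff-Δ-H-word w _)
    (trans (∑-single (factorizations-unique (toList w))
                     (≡.subst (λ x → (u , v) ∈ factorizations x) uv≡w (factorizations-complete u v))
                     (λ q≢uv → δ⊗-≢ (q≢uv ∘ sentence⊗-injective)))
           (δ⊗-refl (sentence⊗ (u , v))))

  coeff-Δ-H-word-0 : ∀ w p → (∀ u v → u ++ v ≡ toList w → sentence⊗ (u , v) ≢ p) →
    coeff⊗ (Δ (H (w ∷ []))) p ≈ 0#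
  coeff-Δ-H-word-0 w p uv≢p =
    trans (coeff-Δ-H-word w p)
          (∑-vanishes (All.map (λ { {u , v} uv≡w → δ⊗-≢ (uv≢p u v uv≡w) })
                               (factorizations-sound (toList w))))

  -- Reduces the vanishing of a summand of `Δ̂ ℋ` to one-word sentences, as these are the support of
  -- `ℋ`.
  ℋ-restricts : ∀ (f : Series Sentence) I → (∀ w → w ∷ [] ≡ I → f I ≈ 0#) → ℋ I * f I ≈ 0#
  ℋ-restricts f []          _   = zeroˡ _
  ℋ-restricts f (w ∷ [])    f≈0 = trans (*-identityˡ _) (f≈0 w ≡.refl)
  ℋ-restricts f (_ ∷ _ ∷ _) _   = zeroˡ _

  degree-sentence : ∀ u → degree (sentence u) ≡ length u
  degree-sentence []      = ≡.refl
  degree-sentence (_ ∷ u) = ℕ.+-identityʳ _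

  -- Places `w ∷ []` in the finite list over which `Δ̂` sums at `sentence⊗ (u , v)`.
  degree-sentence-++ : ∀ u v w → u ++ v ≡ toList w →
                       degree (w ∷ []) ≡ degree (sentence u) +ℕ degree (sentence v)
  degree-sentence-++ u v w uv≡w = begin
    degree (w ∷ [])                                 ≡⟨ degree-sentence (toList w) ⟩
    length (toList w)                               ≡⟨ ≡.cong length uv≡w ⟨
    length (u ++ v)                                 ≡⟨ List.length-++ u ⟩
    length u +ℕ length v                            ≡⟨ ≡.cong₂ _+ℕ_ (degree-sentence u) (degree-sentence v) ⟨
    degree (sentence u) +ℕ degree (sentence v)      ∎
    where open ≡.≡-Reasoning

  Δ̂ℋ-1 : ∀ u v w → u ++ v ≡ toList w → Δ̂ ℋ (sentence⊗ (u , v)) ≈ 1#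
  Δ̂ℋ-1 u v w uv≡w =
    trans (∑-single (sentencesOfDegree-unique (degree (sentence u) +ℕ degree (sentence v)))
                    (≡.subst (λ d → w ∷ [] ∈ sentencesOfDegree d) (degree-sentence-++ u v w uv≡w)
                             (sentencesOfDegree-complete (w ∷ [])))
                    (λ {I} I≢w → ℋ-restricts (λ I → coeff⊗ (Δ (H I)) p) I (off-w I≢w)))
          (trans (*-identityˡ _) (coeff-Δ-H-word-1 u v w uv≡w))
    where
    p = sentence⊗ (u , v)

    toList-injective : ∀ {x y : List⁺ A} → toList x ≡ toList y → x ≡ y
    toList-injective {_ ∷ _} {_ ∷ _} ≡.refl = ≡.refl

    -- If another word `x` contributed at `p`, some factorization of `x` would have the sentences of
    -- `u` and `v`; it would then be `(u , v)` itself, forcing `x` to equal `w`.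
    off-w : ∀ {I} → I ≢ w ∷ [] → ∀ x → x ∷ [] ≡ I → coeff⊗ (Δ (H I)) p ≈ 0#
    off-w I≢w x ≡.refl = coeff-Δ-H-word-0 x p λ u′ v′ uv′≡x eq →
      I≢w (≡.cong (_∷ []) (toList-injective
        (≡.trans (≡.sym uv′≡x)
          (≡.trans (≡.cong (λ (s , t) → s ++ t) (sentence⊗-injective {u′ , v′} {u , v} eq)) uv≡w))))

  -- Only factorizations of non-empty words can contribute, since `ℋ` has no term at the empty
  -- sentence; hence the assumption may exclude the pair of empty words.
  Δ̂ℋ-0 : ∀ p → (∀ u v → u ++ v ≢ [] → sentence⊗ (u , v) ≢ p) → Δ̂ ℋ p ≈ 0#
  Δ̂ℋ-0 p@(J , L) uv≢p = ∑-vanishes (All.universal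
    (λ I → ℋ-restricts (λ I → coeff⊗ (Δ (H I)) p) I
       λ { w ≡.refl → coeff-Δ-H-word-0 w p λ u v uv≡w →
             uv≢p u v λ uv≡[] → toList≢[] w (≡.trans (≡.sym uv≡w) uv≡[]) })
    (sentencesOfDegree (degree J +ℕ degree L)))
    where
    toList≢[] : ∀ w → toList w ≢ []
    toList≢[] (_ ∷ _) ()

  sentence-short : ∀ u {w x I} → sentence u ≢ w ∷ x ∷ I
  sentence-short []      ()
  sentence-short (_ ∷ _) ()

  𝟏-[] : 𝟏 [] ≈ 1#
  𝟏-[] = ⟪⟫-basis (δ []) []

  𝟏-∷ : ∀ w I → 𝟏 (w ∷ I) ≈ 0#
  -- The test `[] ≟ˢ (w ∷ I)` computes to false, so the value of `δ` here is already `0#`.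
  𝟏-∷ w I = ⟪⟫-basis (δ (w ∷ I)) []

  +-cong₃ : ∀ {x y z x′ y′ z′} → x ≈ x′ → y ≈ y′ → z ≈ z′ → x + y + z ≈ x′ + y′ + z′
  +-cong₃ p q r = +-cong (+-cong p q) r

  0+0+x : ∀ x → 0# + 0# + x ≈ x
  0+0+x x = trans (+-congʳ (+-identityˡ 0#)) (+-identityˡ x)

  Δ̂ℋ : Δ̂ ℋ ≋ 𝟏 ⊗ ℋ ⊕ ℋ ⊗ 𝟏 ⊕ ℋ ⊗ ℋ
  -- Only the pair of empty words maps to `([] , [])`. On the right, every product has the factor
  -- `ℋ [] = 0#`.
  Δ̂ℋ ([] , []) = trans
    (Δ̂ℋ-0 ([] , []) λ { [] [] uv≢[] _ → uv≢[] ≡.refl ; [] (_ ∷ _) _ () ; (_ ∷ _) _ _ () })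
    (sym (trans (+-cong₃ (zeroʳ _) (zeroˡ _) (zeroˡ _)) (0+0+x 0#)))
  -- Exposing the constructor of `v` lets `sentence (toList v)` reduce to `v ∷ []`. Only `𝟏 ⊗ ℋ`
  -- survives; in the mirrored case only `ℋ ⊗ 𝟏` does.
  Δ̂ℋ ([] , v@(_ ∷ _) ∷ []) = trans
    (Δ̂ℋ-1 [] (toList v) v ≡.refl)
    (sym (trans (+-cong₃ (trans (*-identityʳ _) 𝟏-[]) (zeroˡ _) (zeroˡ _))
                (trans (+-identityʳ _) (+-identityʳ _))))
  Δ̂ℋ (u@(_ ∷ _) ∷ [] , []) = trans
    (Δ̂ℋ-1 (toList u) [] u (List.++-identityʳ _))
    (sym (trans (+-cong₃ (zeroʳ _) (trans (*-identityˡ _) 𝟏-[]) (zeroʳ _))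
                (trans (+-identityʳ _) (+-identityˡ _))))
  Δ̂ℋ (u@(a ∷ as) ∷ [] , v@(_ ∷ _) ∷ []) = trans
    -- The contributing word is the concatenation of `u` and `v`; it is matched by `ℋ ⊗ ℋ` alone, as
    -- `𝟏` vanishes on both components.
    (Δ̂ℋ-1 (toList u) (toList v) (a ∷ as ++ toList v) ≡.refl)
    (sym (trans (+-cong₃ (trans (*-identityʳ _) (𝟏-∷ u [])) (trans (*-identityˡ _) (𝟏-∷ v []))
                         (*-identityˡ 1#))
                (0+0+x 1#)))
  -- A component with two or more words is not the sentence of any word, and both `𝟏` and `ℋ` vanish
  -- on it.
  Δ̂ℋ (w ∷ x ∷ J , L) = trans
    (Δ̂ℋ-0 (w ∷ x ∷ J , L) λ u _ _ eq → sentence-short u (≡.cong proj₁ eq))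
    (sym (trans (+-cong₃ (trans (*-congʳ (𝟏-∷ w (x ∷ J))) (zeroˡ _)) (zeroˡ _) (zeroˡ _)) (0+0+x 0#)))
  Δ̂ℋ (J , w ∷ x ∷ L) = trans
    (Δ̂ℋ-0 (J , w ∷ x ∷ L) λ _ v _ eq → sentence-short v (≡.cong proj₂ eq))
    (sym (trans (+-cong₃ (zeroʳ _) (trans (*-congˡ (𝟏-∷ w (x ∷ L))) (zeroʳ _)) (zeroʳ _)) (0+0+x 0#)))

proposition6p5 : ∀ {c ℓ a n} (𝕜 : CommutativeRing c ℓ) → IsField 𝕜 → HasCharacteristicZero 𝕜 →
    {A : Set a} (finite : A ↔ Fin n) →
    let open Linear 𝕜
        open NSym 𝕜 finite
    in Δ̂ ℋ ≋ 𝟏 ⊗ ℋ ⊕ ℋ ⊗ 𝟏 ⊕ ℋ ⊗ ℋ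
proposition6p5 𝕜 _ _ finite = PruningCoproduct.Δ̂ℋ 𝕜 finite
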